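{- A point $t\in T(G,g_0)$ is irreducible if and only if there do not exist $u,v\in T(G,g_0)$, both different from $t$, and $\lambda\in(0,1)$ such that $t=\lambda u+(1-\lambda)v$.
   Context: Let $G$ be a finite abelian group of order $D$ with zero element $0$, and let $G^+=G\setminus\{0\}$. For $g_0\in G$, let $T(G,g_0)$ be the set of vectors $t=(t(g))_{g\in G^+}\in\mathbb{Z}_{\ge 0}^{G^+}$ with $\sum_{g\in G^+}t(g)g=g_0$ (sum computed in $G$), where the zero vector is excluded when $g_0=0$. The master corner polyhedron is $P(G,g_0)=\mathrm{conv}\,T(G,g_0)\subset\mathbb{R}^{G^+}$. A point $t\in T(G,g_0)$ is called irreducible if for all integer vectors $r,s$ with $0\le r(g),s(g)\le t(g)$ for all $g\in G^+$ and $\sum_{g\in G^+}r(g)g=\sum_{g\in G^+}s(g)g$, one has $r=s$.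
   Formalization: The "if" direction (no such u, v, λ implies irreducible) is stated only for g_0 ≠ 0; for g_0 = 0 it fails, e.g. G = Z/2, t = 2, since r = 0 and s = t have equal sums. The "only if" direction is stated for every g_0. -}

module Defs where

open import Algebra.Bundles using (AbelianGroup)
import Algebra.Properties.CommutativeMonoid.Mult as Mult
import Algebra.Properties.CommutativeMonoid.Sum as Sum
open import Data.Fin.Base using (Fin)
import Data.Fin.Properties as Fin
open import Data.Integer.Base as ℤ using (+_)
open import Data.Nat.Base as ℕ using (ℕ)
import Data.Nat.Properties as ℕ
open import Data.Product.Base using (Σ; ∃-syntax; _×_; _,_; proj₁; proj₂)
open import Data.Rational.Base as ℚ using (ℚ; 0ℚ; 1ℚ; ½; ∣_∣)
import Data.Rational.Properties as ℚ
open import Data.Rational.Solver using (module +-*-Solver)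
open import Function.Bundles using (Func; Inverse)
open import Function.Properties.Inverse using (Inverse⇒Injection)
open import Level using (_⊔_)
open import Relation.Binary.Bundles using (Setoid)
import Relation.Binary.Construct.On as On
open import Relation.Binary.Definitions using (Decidable)
open import Relation.Binary.PropositionalEquality
  using (_≡_; refl; sym; trans; cong; cong₂; subst)
import Relation.Binary.PropositionalEquality.Properties as ≡
open import Relation.Nullary.Decidable using (Dec; yes; no; via-injection)
open import Relation.Nullary.Negation using (¬_)

-- Real numbers as Cauchy sequences of rationals, with equality up to
-- null sequences and arithmetic computed termwise.

module Real where

  IsCauchy : (ℕ → ℚ) → Set
  IsCauchy x = ∀ ε → 0ℚ ℚ.< ε →
    ∃[ N ] (∀ m n → N ℕ.≤ m → N ℕ.≤ n → ∣ x m ℚ.- x n ∣ ℚ.< ε)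

  record ℝ : Set where
    constructor mkℝ
    field
      seq    : ℕ → ℚ
      cauchy : IsCauchy seq

  open ℝ public

  infix  4 _≈_ _<_
  infixl 6 _+_ _-_
  infixl 7 _*_
  infix  8 -_

  _≈_ : ℝ → ℝ → Set
  x ≈ y = ∀ ε → 0ℚ ℚ.< ε →
    ∃[ N ] (∀ n → N ℕ.≤ n → ∣ seq x n ℚ.- seq y n ∣ ℚ.< ε)

  _<_ : ℝ → ℝ → Set
  x < y = ∃[ ε ] 0ℚ ℚ.< ε ×
    (∃[ N ] (∀ n → N ℕ.≤ n → seq x n ℚ.+ ε ℚ.< seq y n))

  private
    half-pos : ∀ {ε} → 0ℚ ℚ.< ε → 0ℚ ℚ.< ½ ℚ.* ε
    half-pos {ε} 0<ε = subst (ℚ._< ½ ℚ.* ε) (ℚ.*-zeroʳ ½) (ℚ.*-monoʳ-<-pos ½ 0<ε)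

    half+half : ∀ ε → ½ ℚ.* ε ℚ.+ ½ ℚ.* ε ≡ ε
    half+half ε = trans (sym (ℚ.*-distribʳ-+ ε ½ ½)) (ℚ.*-identityˡ ε)

    divide-pos : ∀ c ε → 0ℚ ℚ.< c → 0ℚ ℚ.< ε → ∃[ δ ] 0ℚ ℚ.< δ × c ℚ.* δ ≡ ε
    divide-pos c ε 0<c 0<ε =
      c⁻¹ ℚ.* ε
      , subst (ℚ._< c⁻¹ ℚ.* ε) (ℚ.*-zeroʳ c⁻¹) (ℚ.*-monoʳ-<-pos c⁻¹ 0<ε)
      , trans (sym (ℚ.*-assoc c c⁻¹ ε))
          (trans (cong (ℚ._* ε) (ℚ.*-inverseʳ c)) (ℚ.*-identityˡ ε))
      where
      instance
        c-pos : ℚ.Positive c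
        c-pos = ℚ.positive 0<c
        c≢0 : ℚ.NonZero c
        c≢0 = ℚ.pos⇒nonZero c
      c⁻¹ : ℚ
      c⁻¹ = ℚ.1/ c
      instance
        c⁻¹-pos : ℚ.Positive c⁻¹
        c⁻¹-pos = ℚ.1/pos⇒pos c

    constant-cauchy : ∀ q → IsCauchy (λ _ → q)
    constant-cauchy q ε 0<ε =
      0 , λ _ _ _ _ → subst (ℚ._< ε) (sym (cong ∣_∣ (ℚ.+-inverseʳ q))) 0<ε

    +-cauchy : ∀ {x y} → IsCauchy x → IsCauchy y → IsCauchy (λ n → x n ℚ.+ y n)
    +-cauchy {x} {y} cx cy ε 0<ε with cx (½ ℚ.* ε) (half-pos 0<ε) | cy (½ ℚ.* ε) (half-pos 0<ε)
    ... | M , px | N , py = M ℕ.⊔ N , λ m n m≥ n≥ → begin-strict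
        ∣ (x m ℚ.+ y m) ℚ.- (x n ℚ.+ y n) ∣
          ≡⟨ cong ∣_∣ (regroup (x m) (y m) (x n) (y n)) ⟩
        ∣ (x m ℚ.- x n) ℚ.+ (y m ℚ.- y n) ∣
          ≤⟨ ℚ.∣p+q∣≤∣p∣+∣q∣ (x m ℚ.- x n) (y m ℚ.- y n) ⟩
        ∣ x m ℚ.- x n ∣ ℚ.+ ∣ y m ℚ.- y n ∣
          <⟨ ℚ.+-mono-< (px m n (ℕ.m⊔n≤o⇒m≤o M N m≥) (ℕ.m⊔n≤o⇒m≤o M N n≥))
                        (py m n (ℕ.m⊔n≤o⇒n≤o M N m≥) (ℕ.m⊔n≤o⇒n≤o M N n≥)) ⟩
        ½ ℚ.* ε ℚ.+ ½ ℚ.* ε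
          ≡⟨ half+half ε ⟩
        ε ∎
      where
      open ℚ.≤-Reasoning
      open +-*-Solver
      regroup : ∀ a b c d → (a ℚ.+ b) ℚ.- (c ℚ.+ d) ≡ (a ℚ.- c) ℚ.+ (b ℚ.- d)
      regroup = solve 4 (λ a b c d → (a :+ b) :- (c :+ d) := (a :- c) :+ (b :- d)) refl

    neg-cauchy : ∀ {x} → IsCauchy x → IsCauchy (λ n → ℚ.- x n)
    neg-cauchy {x} cx ε 0<ε with cx ε 0<ε
    ... | N , px = N , λ m n m≥ n≥ →
      subst (ℚ._< ε)
        (trans (sym (ℚ.∣-p∣≡∣p∣ (x m ℚ.- x n))) (cong ∣_∣ (ℚ.neg-distrib-+ (x m) (ℚ.- x n))))
        (px m n m≥ n≥)

    eventually-bounded : ∀ {x} → IsCauchy x →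
      ∃[ B ] 0ℚ ℚ.< B × (∃[ N ] (∀ n → N ℕ.≤ n → ∣ x n ∣ ℚ.≤ B))
    eventually-bounded {x} cx with cx 1ℚ (ℚ.positive⁻¹ 1ℚ)
    ... | N , px =
      1ℚ ℚ.+ ∣ x N ∣
      , ℚ.+-mono-<-≤ (ℚ.positive⁻¹ 1ℚ) (ℚ.0≤∣p∣ (x N))
      , N
      , λ n n≥ → begin
          ∣ x n ∣                         ≡⟨ cong ∣_∣ (split (x n) (x N)) ⟩
          ∣ (x n ℚ.- x N) ℚ.+ x N ∣       ≤⟨ ℚ.∣p+q∣≤∣p∣+∣q∣ (x n ℚ.- x N) (x N) ⟩
          ∣ x n ℚ.- x N ∣ ℚ.+ ∣ x N ∣     ≤⟨ ℚ.+-monoˡ-≤ ∣ x N ∣ (ℚ.<⇒≤ (px n N n≥ ℕ.≤-refl)) ⟩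
          1ℚ ℚ.+ ∣ x N ∣                  ∎
      where
      open ℚ.≤-Reasoning
      open +-*-Solver
      split : ∀ a b → a ≡ (a ℚ.- b) ℚ.+ b
      split = solve 2 (λ a b → a := (a :- b) :+ b) refl

    product-bound : ∀ B δ a b → 0ℚ ℚ.< B → ∣ a ∣ ℚ.≤ B → ∣ b ∣ ℚ.< δ → ∣ a ℚ.* b ∣ ℚ.< B ℚ.* δ
    product-bound B δ a b 0<B a≤B b<δ = begin-strict
        ∣ a ℚ.* b ∣      ≡⟨ ℚ.∣p*q∣≡∣p∣*∣q∣ a b ⟩
        ∣ a ∣ ℚ.* ∣ b ∣  ≤⟨ ℚ.*-monoʳ-≤-nonNeg ∣ b ∣ {{ℚ.nonNegative (ℚ.0≤∣p∣ b)}} a≤B ⟩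
        B ℚ.* ∣ b ∣      <⟨ ℚ.*-monoʳ-<-pos B {{ℚ.positive 0<B}} b<δ ⟩
        B ℚ.* δ          ∎
      where open ℚ.≤-Reasoning

    product-difference-bound : ∀ A B δ a b c d → 0ℚ ℚ.< A → 0ℚ ℚ.< B →
      ∣ a ∣ ℚ.≤ A → ∣ d ∣ ℚ.≤ B → ∣ a ℚ.- c ∣ ℚ.< δ → ∣ b ℚ.- d ∣ ℚ.< δ →
      ∣ a ℚ.* b ℚ.- c ℚ.* d ∣ ℚ.< (A ℚ.+ B) ℚ.* δ
    product-difference-bound A B δ a b c d 0<A 0<B a≤A d≤B ac<δ bd<δ = begin-strict
        ∣ a ℚ.* b ℚ.- c ℚ.* d ∣
          ≡⟨ cong ∣_∣ (regroup a b c d) ⟩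
        ∣ a ℚ.* (b ℚ.- d) ℚ.+ d ℚ.* (a ℚ.- c) ∣
          ≤⟨ ℚ.∣p+q∣≤∣p∣+∣q∣ (a ℚ.* (b ℚ.- d)) (d ℚ.* (a ℚ.- c)) ⟩
        ∣ a ℚ.* (b ℚ.- d) ∣ ℚ.+ ∣ d ℚ.* (a ℚ.- c) ∣
          <⟨ ℚ.+-mono-< (product-bound A δ a (b ℚ.- d) 0<A a≤A bd<δ)
                        (product-bound B δ d (a ℚ.- c) 0<B d≤B ac<δ) ⟩
        A ℚ.* δ ℚ.+ B ℚ.* δ
          ≡⟨ sym (ℚ.*-distribʳ-+ δ A B) ⟩
        (A ℚ.+ B) ℚ.* δ ∎
      where
      open ℚ.≤-Reasoning
      open +-*-Solver
      regroup : ∀ a b c d →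
        a ℚ.* b ℚ.- c ℚ.* d ≡ a ℚ.* (b ℚ.- d) ℚ.+ d ℚ.* (a ℚ.- c)
      regroup = solve 4 (λ a b c d → a :* b :- c :* d := a :* (b :- d) :+ d :* (a :- c)) refl

    *-cauchy : ∀ {x y} → IsCauchy x → IsCauchy y → IsCauchy (λ n → x n ℚ.* y n)
    *-cauchy {x} {y} cx cy ε 0<ε =
      (K ℕ.⊔ L) ℕ.⊔ (M ℕ.⊔ N) , λ m n m≥ n≥ →
        subst (∣ x m ℚ.* y m ℚ.- x n ℚ.* y n ∣ ℚ.<_) eq
          (product-difference-bound A B δ (x m) (y m) (x n) (y n) 0<A 0<B
            (x≤A m (≥K m≥)) (y≤B n (≥L n≥))
            (px m n (≥M m≥) (≥M n≥)) (py m n (≥N m≥) (≥N n≥)))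
      where
      bounded-x = eventually-bounded {x} cx
      bounded-y = eventually-bounded {y} cy
      A = proj₁ bounded-x
      B = proj₁ bounded-y
      0<A = proj₁ (proj₂ bounded-x)
      0<B = proj₁ (proj₂ bounded-y)
      K = proj₁ (proj₂ (proj₂ bounded-x))
      L = proj₁ (proj₂ (proj₂ bounded-y))
      x≤A = proj₂ (proj₂ (proj₂ bounded-x))
      y≤B = proj₂ (proj₂ (proj₂ bounded-y))
      quotient = divide-pos (A ℚ.+ B) ε (ℚ.+-mono-< 0<A 0<B) 0<ε
      δ = proj₁ quotient
      0<δ = proj₁ (proj₂ quotient)
      eq = proj₂ (proj₂ quotient)
      M = proj₁ (cx δ 0<δ)
      N = proj₁ (cy δ 0<δ)
      px = proj₂ (cx δ 0<δ)
      py = proj₂ (cy δ 0<δ)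
      ≥K : ∀ {k} → (K ℕ.⊔ L) ℕ.⊔ (M ℕ.⊔ N) ℕ.≤ k → K ℕ.≤ k
      ≥K k≥ = ℕ.m⊔n≤o⇒m≤o K L (ℕ.m⊔n≤o⇒m≤o (K ℕ.⊔ L) (M ℕ.⊔ N) k≥)
      ≥L : ∀ {k} → (K ℕ.⊔ L) ℕ.⊔ (M ℕ.⊔ N) ℕ.≤ k → L ℕ.≤ k
      ≥L k≥ = ℕ.m⊔n≤o⇒n≤o K L (ℕ.m⊔n≤o⇒m≤o (K ℕ.⊔ L) (M ℕ.⊔ N) k≥)
      ≥M : ∀ {k} → (K ℕ.⊔ L) ℕ.⊔ (M ℕ.⊔ N) ℕ.≤ k → M ℕ.≤ k
      ≥M k≥ = ℕ.m⊔n≤o⇒m≤o M N (ℕ.m⊔n≤o⇒n≤o (K ℕ.⊔ L) (M ℕ.⊔ N) k≥)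
      ≥N : ∀ {k} → (K ℕ.⊔ L) ℕ.⊔ (M ℕ.⊔ N) ℕ.≤ k → N ℕ.≤ k
      ≥N k≥ = ℕ.m⊔n≤o⇒n≤o M N (ℕ.m⊔n≤o⇒n≤o (K ℕ.⊔ L) (M ℕ.⊔ N) k≥)

  fromℚ : ℚ → ℝ
  fromℚ q = mkℝ (λ _ → q) (constant-cauchy q)

  fromℕ : ℕ → ℝ
  fromℕ n = fromℚ (+ n ℚ./ 1)

  0ℝ 1ℝ : ℝ
  0ℝ = fromℕ 0
  1ℝ = fromℕ 1

  _+_ : ℝ → ℝ → ℝ
  x + y = mkℝ (λ n → seq x n ℚ.+ seq y n) (+-cauchy {seq x} {seq y} (cauchy x) (cauchy y))

  -_ : ℝ → ℝ
  - x = mkℝ (λ n → ℚ.- seq x n) (neg-cauchy {seq x} (cauchy x))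

  _-_ : ℝ → ℝ → ℝ
  x - y = x + (- y)

  _*_ : ℝ → ℝ → ℝ
  x * y = mkℝ (λ n → seq x n ℚ.* seq y n) (*-cauchy {seq x} {seq y} (cauchy x) (cauchy y))

-- The bijection enum with Fin D says that G is finite of order D.

module MasterCorner {c ℓ} (G : AbelianGroup c ℓ) (D : ℕ)
  (enum : Inverse (AbelianGroup.setoid G) (≡.setoid (Fin D))) where

  open AbelianGroup G using (_≈_; setoid; commutativeMonoid)
  open AbelianGroup G public using (Carrier; _≉_) renaming (ε to 0G)
  open Mult commutativeMonoid using () renaming (_×_ to _·_)
  open Sum commutativeMonoid using (sum)
  open Real using (ℝ; fromℕ; 0ℝ; 1ℝ; _+_; _-_; _*_; _<_)

  infix 4 _≐_ _≤ᵥ_ _∈T_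

  G⁺ : Setoid (c ⊔ ℓ) ℓ
  G⁺ = On.setoid {B = Σ Carrier (_≉ 0G)} setoid proj₁

  -- Nonnegative integer vectors.
  Vector : Set (c ⊔ ℓ)
  Vector = Func G⁺ (≡.setoid ℕ)

  open Func using () renaming (to to infixl 20 _at_)

  _≐_ : Vector → Vector → Set (c ⊔ ℓ)
  t ≐ u = ∀ g → t at g ≡ u at g

  _≤ᵥ_ : Vector → Vector → Set (c ⊔ ℓ)
  r ≤ᵥ t = ∀ g → r at g ℕ.≤ t at g

  0ᵥ : Vector
  0ᵥ = record { to = λ _ → 0 ; cong = λ _ → refl }

  _≟_ : Decidable _≈_
  _≟_ = via-injection (Inverse⇒Injection enum) Fin._≟_

  term : Vector → (g : Carrier) → Dec (g ≈ 0G) → Carrier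
  term t g (yes _)   = 0G
  term t g (no g≉0) = (t at (g , g≉0)) · g

  -- ∑ t(g)g over G⁺, computed over all of G with the summand at 0 set to 0.
  weight : Vector → Carrier
  weight t = sum {D} (λ i → let g = Inverse.from enum i in term t g (g ≟ 0G))

  _∈T_ : Vector → Carrier → Set (c ⊔ ℓ)
  t ∈T g₀ = weight t ≈ g₀ × (g₀ ≈ 0G → ¬ (t ≐ 0ᵥ))

  -- If g₀ ≈ 0G, no t ∈T g₀ satisfies this (take r = 0ᵥ and s = t), although
  -- some t ∈T g₀ may well not be proper convex combinations, such as t = (2)
  -- for G = ℤ/2.
  Irreducible : Vector → Set (c ⊔ ℓ)
  Irreducible t = ∀ (r s : Vector) → r ≤ᵥ t → s ≤ᵥ t → weight r ≈ weight s → r ≐ s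

  -- t = μu + (1 - μ)v in ℝ^G⁺
  IsCombination : ℝ → Vector → Vector → Vector → Set (c ⊔ ℓ)
  IsCombination μ u v t =
    ∀ g → fromℕ (t at g) Real.≈ μ * fromℕ (u at g) + (1ℝ - μ) * fromℕ (v at g)

  ProperConvexCombination : Carrier → Vector → Set (c ⊔ ℓ)
  ProperConvexCombination g₀ t =
    ∃[ u ] ∃[ v ] ∃[ μ ]
      u ∈T g₀ × v ∈T g₀ × ¬ (u ≐ t) × ¬ (v ≐ t) ×
      0ℝ < μ × μ < 1ℝ × IsCombination μ u v t

{-# OPTIONS --safe #-}

-- If t = μu + (1 − μ)v with u, v ≥ 0, then the one of u, v whose
-- coefficient is at least ½, say u, satisfies u ≤ 2t.  Hence (u − t)⁺ and
-- (u − t)⁻ are both bounded by t, and they have equal weight, so irreducibility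
-- makes them equal and u = t.  Conversely, r, s ≤ t with equal weight exhibit t
-- as the midpoint of t − r + s and t − s + r.

module Submission where

open import Defs
open import Algebra.Bundles using (AbelianGroup)
import Algebra.Properties.CommutativeMonoid.Mult as Mult
import Algebra.Properties.CommutativeMonoid.Sum as Sum
import Algebra.Properties.Group as GroupProperties
open import Data.Empty using (⊥; ⊥-elim)
open import Data.Fin.Base using (Fin; zero; suc)
open import Data.Integer.Base as ℤ using (+_)
import Data.Integer.Properties as ℤ
open import Data.Nat.Base as ℕ using (ℕ)
import Data.Nat.Coprimality as Coprimality
import Data.Nat.Properties as ℕ
import Data.Nat.Solver as ℕ
open import Data.Product.Base using (_×_; ∃-syntax; _,_; proj₁; proj₂)
open import Data.Rational.Base as ℚ using (ℚ; 0ℚ; 1ℚ; ½; ∣_∣)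
import Data.Rational.Properties as ℚ
open import Data.Rational.Solver using (module +-*-Solver)
open import Data.Sum.Base using (_⊎_; inj₁; inj₂)
open import Function.Bundles using (Func; Inverse)
open import Relation.Binary.PropositionalEquality
  using (_≡_; refl; sym; trans; cong; cong₂; subst)
open import Relation.Binary.PropositionalEquality.Properties using (setoid)
import Relation.Binary.Reasoning.Setoid as SetoidReasoning
open import Relation.Nullary.Decidable using (yes; no; decidable-stable; from-yes)
open import Relation.Nullary.Negation using (¬_; contradiction)

-- Truncated subtraction and finite bounds on the naturals.

-- Both sides are the maximum of `m` and `n`.
m∸n+n≡n∸m+m : ∀ m n → (m ℕ.∸ n) ℕ.+ n ≡ (n ℕ.∸ m) ℕ.+ m
m∸n+n≡n∸m+m m n with ℕ.≤-total m n
... | inj₁ m≤n = trans (cong (ℕ._+ n) (ℕ.m≤n⇒m∸n≡0 m≤n)) (sym (ℕ.m∸n+n≡m m≤n))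
... | inj₂ n≤m = trans (ℕ.m∸n+n≡m n≤m) (cong (ℕ._+ m) (sym (ℕ.m≤n⇒m∸n≡0 n≤m)))

m∸n≡n∸m⇒m≡n : ∀ m n → m ℕ.∸ n ≡ n ℕ.∸ m → m ≡ n
m∸n≡n∸m⇒m≡n m n eq = ℕ.+-cancelˡ-≡ (m ℕ.∸ n) m n
  (trans (cong (ℕ._+ m) eq) (sym (m∸n+n≡n∸m+m m n)))

-- Serves to merge the convergence thresholds of the single coordinates into one.
fin-bound : ∀ {n} (f : Fin n → ℕ) → ∃[ M ] (∀ i → f i ℕ.≤ M)
fin-bound {ℕ.zero}  f = 0 , λ ()
fin-bound {ℕ.suc n} f with fin-bound (λ i → f (suc i))
... | M , f≤M = f zero ℕ.⊔ M , λ where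
  zero    → ℕ.m≤m⊔n (f zero) M
  (suc i) → ℕ.≤-trans (f≤M i) (ℕ.m≤n⊔m (f zero) M)

-- Convex combinations of naturals inside the rationals.

infix 8 _/1
_/1 : ℕ → ℚ
n /1 = + n ℚ./ 1

/1-homo-+ : ∀ m n → (m ℕ.+ n) /1 ≡ m /1 ℚ.+ n /1
/1-homo-+ m n = sym (trans (cong₂ ℚ._+_ (reduced m) (reduced n))
  (ℚ./-cong (cong₂ ℤ._+_ (ℤ.*-identityʳ (+ m)) (ℤ.*-identityʳ (+ n))) refl))
  where
  coprime-1 : ∀ k → Coprimality.Coprime k 1
  coprime-1 k = Coprimality.sym (Coprimality.1-coprimeTo k)
  -- `_/1` normalises its fraction and is stuck on a variable; on an explicit `ℚ.mkℚ` with
  -- denominator 1 the sum unfolds.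
  reduced : ∀ k → k /1 ≡ ℚ.mkℚ (+ k) 0 (coprime-1 k)
  reduced k = ℚ.normalize-coprime (coprime-1 k)

/1-nonNeg : ∀ n → ℚ.NonNegative (n /1)
/1-nonNeg n = ℚ.normalize-nonNeg n 1

p≤∣p∣ : ∀ p → p ℚ.≤ ∣ p ∣
p≤∣p∣ p with ℚ.≤-total 0ℚ p
... | inj₁ 0≤p = ℚ.≤-reflexive (sym (ℚ.0≤p⇒∣p∣≡p 0≤p))
... | inj₂ p≤0 = ℚ.≤-trans p≤0 (ℚ.0≤∣p∣ p)

-- What `IsCombination` asks to be small at one coordinate and one index, `q` being the term of the
-- real coefficient at that index.
∣residual∣ : ℚ → ℕ → ℕ → ℕ → ℚ
∣residual∣ q x y z = ∣ x /1 ℚ.- (q ℚ.* y /1 ℚ.+ (1ℚ ℚ.- q) ℚ.* z /1) ∣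

∣residual∣-cong : ∀ q {x y z x′ y′ z′} → x ≡ x′ → y ≡ y′ → z ≡ z′ →
  ∣residual∣ q x y z ≡ ∣residual∣ q x′ y′ z′
∣residual∣-cong q refl refl refl = refl

-- Otherwise `z` is at least `x + x + 1` by integrality, and the combination is at least `½ * z`,
-- hence at least `x + ½`. So an approximate equation with error below `½` suffices.
half≤⇒≤double : ∀ p q x y z → ½ ℚ.≤ p → 0ℚ ℚ.≤ q →
  ∣ x /1 ℚ.- (p ℚ.* z /1 ℚ.+ q ℚ.* y /1) ∣ ℚ.< ½ → z ℕ.≤ x ℕ.+ x
half≤⇒≤double p q x y z ½≤p 0≤q close with z ℕ.≤? x ℕ.+ x
... | yes z≤2x = z≤2x
... | no  z≰2x with ℕ.m≤n⇒∃[o]m+o≡n (ℕ.≰⇒> z≰2x)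
... | k , refl = ⊥-elim (ℚ.<-irrefl refl (ℚ.≤-<-trans (begin
  ½                                     ≡⟨ ℚ.+-identityʳ ½ ⟨
  ½ ℚ.+ 0ℚ                              ≤⟨ ℚ.+-monoʳ-≤ ½ 0≤½K ⟩
  ½ ℚ.+ ½ ℚ.* K                         ≡⟨ regroup X K ⟩
  ½ ℚ.* (1ℚ ℚ.+ (X ℚ.+ X) ℚ.+ K) ℚ.- X  ≡⟨ cong (λ Z → ½ ℚ.* Z ℚ.- X) Z≡ ⟨
  ½ ℚ.* Z ℚ.- X                         ≤⟨ ℚ.+-monoˡ-≤ (ℚ.- X) ½Z≤W ⟩
  W ℚ.- X                               ≤⟨ p≤∣p∣ (W ℚ.- X) ⟩
  ∣ W ℚ.- X ∣                           ≡⟨ ℚ.∣-p∣≡∣p∣ (W ℚ.- X) ⟨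
  ∣ ℚ.- (W ℚ.- X) ∣                     ≡⟨ cong ∣_∣ (flip W X) ⟩
  ∣ X ℚ.- W ∣                           ∎) close))
  where
  open ℚ.≤-Reasoning
  open +-*-Solver
  X = x /1
  K = k /1
  Z = (ℕ.suc (x ℕ.+ x) ℕ.+ k) /1
  W = p ℚ.* Z ℚ.+ q ℚ.* y /1

  Z≡ : Z ≡ 1ℚ ℚ.+ (X ℚ.+ X) ℚ.+ K
  Z≡ = trans (/1-homo-+ (ℕ.suc (x ℕ.+ x)) k) (cong (ℚ._+ K)
    (trans (/1-homo-+ 1 (x ℕ.+ x)) (cong (1ℚ ℚ.+_) (/1-homo-+ x x))))

  0≤½K : 0ℚ ℚ.≤ ½ ℚ.* K
  0≤½K = subst (ℚ._≤ ½ ℚ.* K) (ℚ.*-zeroʳ ½)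
    (ℚ.*-monoˡ-≤-nonNeg ½ (ℚ.nonNegative⁻¹ K {{/1-nonNeg k}}))

  0≤qY : 0ℚ ℚ.≤ q ℚ.* y /1
  0≤qY = subst (ℚ._≤ q ℚ.* y /1) (ℚ.*-zeroˡ (y /1))
    (ℚ.*-monoʳ-≤-nonNeg (y /1) {{/1-nonNeg y}} 0≤q)

  ½Z≤W : ½ ℚ.* Z ℚ.≤ W
  ½Z≤W = subst (ℚ._≤ W) (ℚ.+-identityʳ (½ ℚ.* Z))
    (ℚ.+-mono-≤ (ℚ.*-monoʳ-≤-nonNeg Z {{/1-nonNeg (ℕ.suc (x ℕ.+ x) ℕ.+ k)}} ½≤p) 0≤qY)

  regroup : ∀ X K → ½ ℚ.+ ½ ℚ.* K ≡ ½ ℚ.* (1ℚ ℚ.+ (X ℚ.+ X) ℚ.+ K) ℚ.- X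
  regroup = solve 2 (λ X K → con ½ :+ con ½ :* K :=
    con ½ :* (con 1ℚ :+ (X :+ X) :+ K) :- X) refl

  flip : ∀ W X → ℚ.- (W ℚ.- X) ≡ X ℚ.- W
  flip = solve 2 (λ W X → :- (W :- X) := X :- W) refl

midpoint : ∀ x y z → y ℕ.+ z ≡ x ℕ.+ x →
  x /1 ℚ.- (½ ℚ.* y /1 ℚ.+ (1ℚ ℚ.- ½) ℚ.* z /1) ≡ 0ℚ
midpoint x y z eq =
  -- `1ℚ ℚ.- ½` evaluates to `½`, so both terms share the factor `½`.
  trans (cong₂ ℚ._-_ (double (x /1)) (sym (ℚ.*-distribˡ-+ ½ (y /1) (z /1))))
  (trans (cong (λ s → ½ ℚ.* (x /1 ℚ.+ x /1) ℚ.- ½ ℚ.* s) y+z)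
  (ℚ.+-inverseʳ (½ ℚ.* (x /1 ℚ.+ x /1))))
  where
  open +-*-Solver
  double : ∀ X → X ≡ ½ ℚ.* (X ℚ.+ X)
  double = solve 1 (λ X → X := con ½ :* (X :+ X)) refl
  y+z : y /1 ℚ.+ z /1 ≡ x /1 ℚ.+ x /1
  y+z = trans (sym (/1-homo-+ y z)) (trans (cong _/1 eq) (/1-homo-+ x x))

-- Weights, irreducibility and extremality.

module _ {c ℓ} (G : AbelianGroup c ℓ) (D : ℕ)
  (enum : Inverse (AbelianGroup.setoid G) (setoid (Fin D))) where

  open MasterCorner G D enum
  private module G = AbelianGroup G
  open G using (_≈_; _∙_)
  open GroupProperties G.group using (∙-cancelʳ)
  open Mult G.commutativeMonoid using (×-homo-+; ×-congˡ)
  open Sum G.commutativeMonoid using (sum-cong-≋; ∑-distrib-+)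
  open Func using () renaming (to to infixl 20 _at_)
  open Inverse enum using (to; from; strictlyInverseʳ)
  open Real using (seq; fromℚ)
  open SetoidReasoning G.setoid

  zipᵥ : (ℕ → ℕ → ℕ) → Vector → Vector → Vector
  zipᵥ f r s = record
    { to   = λ g → f (r at g) (s at g)
    ; cong = λ g≈h → cong₂ f (Func.cong r g≈h) (Func.cong s g≈h)
    }

  infixl 6 _+ᵥ_ _∸ᵥ_
  _+ᵥ_ _∸ᵥ_ : Vector → Vector → Vector
  _+ᵥ_ = zipᵥ ℕ._+_
  _∸ᵥ_ = zipᵥ ℕ._∸_

  weight-cong : ∀ r s → r ≐ s → weight r ≈ weight s
  weight-cong r s r≐s = sum-cong-≋ {D} (λ i → term-cong (from i) (from i ≟ 0G))
    where
    term-cong : ∀ g d → term r g d ≈ term s g d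
    term-cong g (yes _)   = G.refl
    term-cong g (no g≉0) = ×-congˡ (r≐s (g , g≉0))

  weight-homo-+ : ∀ r s → weight (r +ᵥ s) ≈ weight r ∙ weight s
  weight-homo-+ r s = G.trans
    (sum-cong-≋ {D} (λ i → term-homo-+ (from i) (from i ≟ 0G)))
    (∑-distrib-+ {D} (λ i → term r (from i) (from i ≟ 0G)) _)
    where
    term-homo-+ : ∀ g d → term (r +ᵥ s) g d ≈ term r g d ∙ term s g d
    term-homo-+ g (yes _)   = G.sym (G.identityˡ 0G)
    term-homo-+ g (no g≉0) = ×-homo-+ g (r at (g , g≉0)) (s at (g , g≉0))

  irreducible-≤double : ∀ t u → Irreducible t → weight u ≈ weight t →
    (∀ g → u at g ℕ.≤ t at g ℕ.+ t at g) → u ≐ t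
  irreducible-≤double t u irr wu≈wt u≤2t g = m∸n≡n∸m⇒m≡n (u at g) (t at g)
    (irr (u ∸ᵥ t) (t ∸ᵥ u)
      (λ h → ℕ.m≤n+o⇒m∸n≤o (u at h) (t at h) (u≤2t h))
      (λ h → ℕ.m∸n≤m (t at h) (u at h))
      -- Adding `t` to `u ∸ᵥ t`, or `u` to `t ∸ᵥ u`, gives the coordinatewise maximum; as `u` and
      -- `t` have equal weight, it cancels.
      (∙-cancelʳ (weight t) _ _ (begin
        weight (u ∸ᵥ t) ∙ weight t  ≈⟨ weight-homo-+ (u ∸ᵥ t) t ⟨
        weight (u ∸ᵥ t +ᵥ t)        ≈⟨ weight-cong (u ∸ᵥ t +ᵥ t) (t ∸ᵥ u +ᵥ u)
                                         (λ h → m∸n+n≡n∸m+m (u at h) (t at h)) ⟩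
        weight (t ∸ᵥ u +ᵥ u)        ≈⟨ weight-homo-+ (t ∸ᵥ u) u ⟩
        weight (t ∸ᵥ u) ∙ weight u  ≈⟨ G.∙-congˡ wu≈wt ⟩
        weight (t ∸ᵥ u) ∙ weight t  ∎))
      g)

  Close : ℚ → Vector → Vector → Vector → Set _
  Close q u v t = ∀ g → ∣residual∣ q (t at g) (u at g) (v at g) ℚ.< ½

  -- Each coordinate has its own threshold. Indexing by `Fin D` leaves finitely many, and vectors
  -- respect `_≈_`, so the representative `from i` speaks for every `g` equal to it.
  eventually-close : ∀ μ u v t → IsCombination μ u v t →
    ∃[ N ] (∀ n → N ℕ.≤ n → Close (seq μ n) u v t)
  eventually-close μ u v t comb =
    proj₁ bound , λ n n≥ g → proj₂ (at-index (to (proj₁ g))) n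
      (ℕ.≤-trans (proj₂ bound (to (proj₁ g))) n≥) g
      (G.sym (strictlyInverseʳ (proj₁ g)))
    where
    at-index : ∀ i → ∃[ N ] (∀ n → N ℕ.≤ n → ∀ g → proj₁ g ≈ from i →
      ∣residual∣ (seq μ n) (t at g) (u at g) (v at g) ℚ.< ½)
    at-index i with from i ≟ 0G
    -- The index of zero carries no coordinate, so its threshold is arbitrary.
    ... | yes i≈0 = 0 , λ _ _ g g≈i → contradiction (G.trans g≈i i≈0) (proj₂ g)
    ... | no  i≉0 with comb (from i , i≉0) ½ (ℚ.positive⁻¹ ½)
    ...   | N , close = N , λ n n≥ g g≈i → subst (ℚ._< ½)
            (sym (∣residual∣-cong (seq μ n)
              (Func.cong t {g} g≈i) (Func.cong u {g} g≈i) (Func.cong v {g} g≈i)))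
            (close n n≥)
    bound = fin-bound (λ i → proj₁ (at-index i))

  -- The real `μ` is replaced by one late rational term `q`: which of `q` and `1ℚ ℚ.- q` is at least
  -- `½` is decidable, unlike the same question for a Cauchy real.
  irreducible⇒extreme : ∀ g₀ t → t ∈T g₀ → Irreducible t → ¬ ProperConvexCombination g₀ t
  irreducible⇒extreme g₀ t (wt , _) irr
    (u , v , μ , (wu , _) , (wv , _) , u≢t , v≢t
      , (ε , 0<ε , K , 0<μ) , (δ , 0<δ , L , μ<1) , comb) =
    by-larger-coefficient (ℚ.≤-total ½ q)
    where
    M = proj₁ (eventually-close μ u v t comb)
    close = proj₂ (eventually-close μ u v t comb)
    -- Late enough for positivity of `μ`, for `μ < 1` and for closeness at all coordinates at once.
    n = K ℕ.⊔ (L ℕ.⊔ M)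
    q = seq μ n
    close-n : Close q u v t
    close-n = close n (ℕ.≤-trans (ℕ.m≤n⊔m L M) (ℕ.m≤n⊔m K (L ℕ.⊔ M)))
    0≤q : 0ℚ ℚ.≤ q
    0≤q = ℚ.<⇒≤ (ℚ.<-trans 0<ε (subst (ℚ._< q) (ℚ.+-identityˡ ε)
      (0<μ n (ℕ.m≤m⊔n K (L ℕ.⊔ M)))))
    q≤1 : q ℚ.≤ 1ℚ
    q≤1 = ℚ.<⇒≤ (ℚ.≤-<-trans
      (subst (ℚ._≤ q ℚ.+ δ) (ℚ.+-identityʳ q) (ℚ.+-monoʳ-≤ q (ℚ.<⇒≤ 0<δ)))
      (μ<1 n (ℕ.≤-trans (ℕ.m≤m⊔n L M) (ℕ.m≤n⊔m K (L ℕ.⊔ M)))))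
    ½≤1-q : q ℚ.≤ ½ → ½ ℚ.≤ 1ℚ ℚ.- q
    ½≤1-q q≤½ = ℚ.+-monoʳ-≤ 1ℚ (ℚ.neg-antimono-≤ q≤½)
    0≤1-q : 0ℚ ℚ.≤ 1ℚ ℚ.- q
    0≤1-q = ℚ.+-monoʳ-≤ 1ℚ (ℚ.neg-antimono-≤ q≤1)
    by-larger-coefficient : ½ ℚ.≤ q ⊎ q ℚ.≤ ½ → ⊥
    by-larger-coefficient (inj₁ ½≤q) = u≢t
      (irreducible-≤double t u irr (G.trans wu (G.sym wt)) λ g →
        half≤⇒≤double q (1ℚ ℚ.- q) (t at g) (v at g) (u at g) ½≤q 0≤1-q (close-n g))
    by-larger-coefficient (inj₂ q≤½) = v≢t
      (irreducible-≤double t v irr (G.trans wv (G.sym wt)) λ g →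
        half≤⇒≤double (1ℚ ℚ.- q) q (t at g) (u at g) (v at g) (½≤1-q q≤½) 0≤q
          (subst (λ w → ∣ (t at g) /1 ℚ.- w ∣ ℚ.< ½)
            (ℚ.+-comm (q ℚ.* (u at g) /1) ((1ℚ ℚ.- q) ℚ.* (v at g) /1)) (close-n g)))

  -- Equality of naturals is decidable, so it is enough to refute a difference at `g`. Such a
  -- difference makes both exchanged vectors differ from `t`.
  extreme⇒irreducible : ∀ g₀ t → t ∈T g₀ → g₀ ≉ 0G →
    ¬ ProperConvexCombination g₀ t → Irreducible t
  extreme⇒irreducible g₀ t (wt , _) g₀≉0 extreme r s r≤t s≤t wr≈ws g =
    decidable-stable (r at g ℕ.≟ s at g) λ r≢s → extreme
      ( t ∸ᵥ r +ᵥ s , t ∸ᵥ s +ᵥ r , fromℚ ½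
      -- Here `g₀ ≉ 0G` rules out a zero vector: for `g₀` zero, exchanging `r = t` for `s = 0ᵥ`
      -- would produce one.
      , (weight-exchange r s r≤t wr≈ws , λ g₀≈0 → contradiction g₀≈0 g₀≉0)
      , (weight-exchange s r s≤t (G.sym wr≈ws) , λ g₀≈0 → contradiction g₀≈0 g₀≉0)
      , (λ eq → r≢s (sym (exchange-injective r s r≤t g (eq g))))
      , (λ eq → r≢s (exchange-injective s r s≤t g (eq g)))
      -- A margin of one quarter separates `½` from both 0 and 1.
      , (½ ℚ.* ½ , ℚ.positive⁻¹ (½ ℚ.* ½) , 0 , λ _ _ → from-yes (0ℚ ℚ.+ ½ ℚ.* ½ ℚ.<? ½))
      , (½ ℚ.* ½ , ℚ.positive⁻¹ (½ ℚ.* ½) , 0 , λ _ _ → from-yes (½ ℚ.+ ½ ℚ.* ½ ℚ.<? 1ℚ))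
      -- The coefficient is a constant sequence and the residual is exactly zero, so every index
      -- works.
      , λ h ε 0<ε → 0 , λ _ _ → subst (ℚ._< ε)
          (sym (cong ∣_∣ (midpoint (t at h) ((t ∸ᵥ r +ᵥ s) at h) ((t ∸ᵥ s +ᵥ r) at h) (sum-exchanges h)))) 0<ε )
    where
    weight-exchange : ∀ r s → r ≤ᵥ t → weight r ≈ weight s → weight (t ∸ᵥ r +ᵥ s) ≈ g₀
    weight-exchange r s r≤t wr≈ws = begin
      weight (t ∸ᵥ r +ᵥ s)        ≈⟨ weight-homo-+ (t ∸ᵥ r) s ⟩
      weight (t ∸ᵥ r) ∙ weight s  ≈⟨ G.∙-congˡ wr≈ws ⟨
      weight (t ∸ᵥ r) ∙ weight r  ≈⟨ weight-homo-+ (t ∸ᵥ r) r ⟨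
      weight (t ∸ᵥ r +ᵥ r)        ≈⟨ weight-cong (t ∸ᵥ r +ᵥ r) t (λ h → ℕ.m∸n+n≡m (r≤t h)) ⟩
      weight t                    ≈⟨ wt ⟩
      g₀                          ∎

    exchange-injective : ∀ r s → r ≤ᵥ t → ∀ h →
      (t ∸ᵥ r +ᵥ s) at h ≡ t at h → s at h ≡ r at h
    exchange-injective r s r≤t h eq = ℕ.+-cancelˡ-≡ (t at h ℕ.∸ r at h) _ _
      (trans eq (sym (ℕ.m∸n+n≡m (r≤t h))))

    sum-exchanges : ∀ h →
      (t ∸ᵥ r +ᵥ s) at h ℕ.+ (t ∸ᵥ s +ᵥ r) at h ≡ t at h ℕ.+ t at h
    sum-exchanges h = trans (swap (t at h ℕ.∸ r at h) (s at h) (t at h ℕ.∸ s at h) (r at h))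
      (cong₂ ℕ._+_ (ℕ.m∸n+n≡m (r≤t h)) (ℕ.m∸n+n≡m (s≤t h)))
      where
      open ℕ.+-*-Solver
      swap : ∀ a b c d → (a ℕ.+ b) ℕ.+ (c ℕ.+ d) ≡ (a ℕ.+ d) ℕ.+ (c ℕ.+ b)
      swap = solve 4 (λ a b c d → (a :+ b) :+ (c :+ d) := (a :+ d) :+ (c :+ b)) refl

theorem1 : ∀ {c ℓ} (G : AbelianGroup c ℓ) (D : ℕ)
    (enum : Inverse (AbelianGroup.setoid G) (setoid (Fin D))) →
    let open MasterCorner G D enum in
    (g₀ : Carrier) (t : Vector) → t ∈T g₀ →
    (Irreducible t → ¬ ProperConvexCombination g₀ t) ×
    (g₀ ≉ 0G → ¬ ProperConvexCombination g₀ t → Irreducible t)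
theorem1 G D enum g₀ t t∈T =
  irreducible⇒extreme G D enum g₀ t t∈T , extreme⇒irreducible G D enum g₀ t t∈T
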